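{- For every sufficiently large positive integer $n$, there exists a string $Y$ of length $n$ such that $z(Y)/c(Y) \in \Omega(\log n)$. That is, there exist constants $\kappa>0$ and $n_0$ such that for every integer $n\ge n_0$ there is a string $Y$ with $|Y|=n$ and $z(Y)\ge \kappa \log n\cdot c(Y)$.
   Context: The alphabet is not fixed: the string may be over an alphabet depending on $n$. Strings are indexed from $0$: a string $S$ of length $n=|S|$ is $S[0]\cdots S[n-1]$, and $S[i..j]$ is the substring from position $i$ to position $j$. A factorization of $S$ is a sequence of nonempty strings (phrases) $F_1,\dots,F_m$ with $S=F_1\cdots F_m$; the starting position of $F_i$ is $b_i=\sum_{k=1}^{i-1}|F_k|$. The Lempel--Ziv (LZ) factorization of $S$ is built from left to right: if the character $S[b_i]$ has no occurrence in $S$ starting before $b_i$, then $F_i=S[b_i]$; otherwise $F_i$ is the longest prefix of $S[b_i..n-1]$ that has an occurrence in $S$ starting before $b_i$ (this earlier occurrence may overlap $F_i$). The number of phrases is denoted $z(S)$. A collage system is a sequence of nonterminals $X_1,\dots,X_m$ with exactly one production rule for each nonterminal; the rule for $X_i$ has one of the following forms and recursively defines a string $\exp(X_i)$: (1) $X_i\to a$ for a character $a$, with $\exp(X_i)=a$; (2) $X_i\to X_jX_k$ with $j,k<i$, with $\exp(X_i)=\exp(X_j)\exp(X_k)$; (3) $X_i\to (X_j)^r$ with $j<i$ and an integer $r\ge 2$, with $\exp(X_i)=\exp(X_j)^r$; (4) $X_i\to X_j[b..e]$ with $j<i$ and integers $0\le b\le e<|\exp(X_j)|$, with $\exp(X_i)=\exp(X_j)[b..e]$.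 The system derives $S$ if $\exp(X_m)=S$; its size is $m$. $c(S)$ is the minimum size of a collage system deriving $S$. -}

module Defs where

open import Data.Empty using (⊥)
open import Data.Fin.Base using (Fin; zero; suc; toℕ)
open import Data.Integer.Base using (+_)
open import Data.List.Base
  using (List; []; _∷_; [_]; _++_; concat; drop; length; lookup; map; replicate; take)
open import Data.List.Properties
  using (++-cancelˡ; ∷-injectiveˡ; drop-drop; length-take)
open import Data.List.Relation.Binary.Prefix.Heterogeneous using (Prefix; []; _∷_)
open import Data.List.Relation.Binary.Prefix.Heterogeneous.Properties using (prefix?; length-mono)
open import Data.List.Relation.Unary.All using (All; []; _∷_)
open import Data.Nat.Base
open import Data.Nat.ListAction using (sum)
open import Data.Nat.Induction using (<-rec)
open import Data.Nat.Properties
open import Data.Product.Base using (∃; ∃-syntax; Σ; _×_; _,_; proj₁)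
open import Data.Rational.Unnormalised.Base using (ℚᵘ; mkℚᵘ)
open import Relation.Binary.Definitions using (DecidableEquality)
open import Relation.Binary.PropositionalEquality
  using (_≡_; _≢_; refl; sym; trans; cong; subst)
open import Relation.Nullary using (¬_; Dec; yes; no; contradiction)
import Data.Fin.Properties as Fin

private
  variable
    A : Set
    m : ℕ

------------------------------------------------------------------------
-- Lempel–Ziv factorization

-- An occurrence starting at j may run past position b, so overlaps with
-- the phrase at b are allowed.
OccursBefore : List A → ℕ → List A → Set
OccursBefore S b F = ∃[ j ] (j < b × Prefix _≡_ F (drop j S))

record IsLongestPreviousFactor (S : List A) (b : ℕ) (F : List A) : Set where
  constructor longestPreviousFactor
  field
    prefix  : Prefix _≡_ F (drop b S)
    occurs  : OccursBefore S b F
    longest : ∀ G → Prefix _≡_ G (drop b S) → OccursBefore S b G → length G ≤ length F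

-- The hypothesis  drop b S ≡ a ∷ T  says that b < |S| and S[b] = a.
data IsLZPhrase (S : List A) (b : ℕ) : List A → Set where
  fresh : ∀ {a T} → drop b S ≡ a ∷ T → ¬ OccursBefore S b [ a ] →
          IsLZPhrase S b [ a ]
  copy  : ∀ {a T F} → drop b S ≡ a ∷ T → OccursBefore S b [ a ] →
          IsLongestPreviousFactor S b F → IsLZPhrase S b F

start : (Fs : List (List A)) → Fin (length Fs) → ℕ
start Fs i = sum (map length (take (toℕ i) Fs))

record IsLZFactorization (S : List A) (Fs : List (List A)) : Set where
  constructor lzFactorization
  field
    factors  : concat Fs ≡ S
    nonempty : All (_≢ []) Fs
    phrases  : ∀ i → IsLZPhrase S (start Fs i) (lookup Fs i)

private
  prefix⇒take : {G T : List A} → Prefix _≡_ G T → G ≡ take (length G) T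
  prefix⇒take []         = refl
  prefix⇒take (refl ∷ p) = cong (_ ∷_) (prefix⇒take p)

  take-prefix : ∀ k (T : List A) → Prefix _≡_ (take k T) T
  take-prefix zero    T       = []
  take-prefix (suc k) []      = []
  take-prefix (suc k) (x ∷ T) = refl ∷ take-prefix k T

  greatest : {P : ℕ → Set} → (∀ k → Dec (P k)) → P 0 → ∀ N →
             ∃[ k ] (k ≤ N × P k × (∀ l → l ≤ N → P l → l ≤ k))
  greatest P? p₀ zero = 0 , z≤n , p₀ , λ _ l≤0 _ → l≤0
  greatest P? p₀ (suc N) with P? (suc N)
  ... | yes p = suc N , ≤-refl , p , λ _ l≤N _ → l≤N
  ... | no ¬p with greatest P? p₀ N
  ...   | k , k≤N , p , max = k , m≤n⇒m≤1+n k≤N , p , λ l l≤1+N q →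
          max l (≤-pred (≤∧≢⇒< l≤1+N λ { refl → ¬p q })) q

  phrase-nonempty : ∀ {S : List A} {b F} → IsLZPhrase S b F → F ≢ []
  phrase-nonempty (fresh _ _) ()
  phrase-nonempty {S = S} {b} (copy {a} eq occ lpf) refl
    with IsLongestPreviousFactor.longest lpf [ a ]
           (subst (Prefix _≡_ [ a ]) (sym eq) (refl ∷ [])) occ
  ... | ()

  phrase-prefix : ∀ {S : List A} {b F} → IsLZPhrase S b F → Prefix _≡_ F (drop b S)
  phrase-prefix (fresh eq _)   = subst (Prefix _≡_ _) (sym eq) (refl ∷ [])
  phrase-prefix (copy _ _ lpf) = IsLongestPreviousFactor.prefix lpf

  prefix-++-drop : {F T : List A} → Prefix _≡_ F T → F ++ drop (length F) T ≡ T
  prefix-++-drop []         = refl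
  prefix-++-drop (refl ∷ p) = cong (_ ∷_) (prefix-++-drop p)

  shift : ∀ {S : List A} {F b b′} → b ≡ b′ → IsLZPhrase S b F → IsLZPhrase S b′ F
  shift refl p = p

  LZFrom : List A → ℕ → List (List A) → Set
  LZFrom S b Fs = concat Fs ≡ drop b S × All (_≢ []) Fs ×
                  (∀ i → IsLZPhrase S (b + start Fs i) (lookup Fs i))

  head-phrase : ∀ {S : List A} {b F Fs} → LZFrom S b (F ∷ Fs) → IsLZPhrase S b F
  head-phrase {b = b} (_ , _ , ph) = shift (+-identityʳ b) (ph zero)

  cons : ∀ {S : List A} {b F Fs} → IsLZPhrase S b F →
         LZFrom S (b + length F) Fs → LZFrom S b (F ∷ Fs)
  cons {S = S} {b} {F} {Fs} p (eq , ne , ph) =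
      trans (cong (F ++_) (trans eq (sym (drop-drop b (length F) S))))
            (prefix-++-drop (phrase-prefix p))
    , phrase-nonempty p ∷ ne
    , λ { zero    → shift (sym (+-identityʳ b)) p
        ; (suc i) → shift (+-assoc b (length F) (start Fs i)) (ph i) }

  uncons : ∀ {S : List A} {b F Fs} → LZFrom S b (F ∷ Fs) → LZFrom S (b + length F) Fs
  uncons {S = S} {b} {F} {Fs} lz@(eq , _ ∷ ne , ph) =
      ++-cancelˡ F _ _
        (trans eq (trans (sym (prefix-++-drop (phrase-prefix (head-phrase lz))))
                         (cong (F ++_) (drop-drop b (length F) S))))
    , ne
    , λ i → shift (sym (+-assoc b (length F) (start Fs i))) (ph (suc i))

  phrase-unique : ∀ {S : List A} {b F G} → IsLZPhrase S b F → IsLZPhrase S b G → F ≡ G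
  phrase-unique (fresh e _) (fresh e′ _) = cong [_] (∷-injectiveˡ (trans (sym e) e′))
  phrase-unique {S = S} {b} (fresh e ¬o) (copy e′ o _) = contradiction
    (subst (λ a → OccursBefore S b [ a ]) (∷-injectiveˡ (trans (sym e′) e)) o) ¬o
  phrase-unique {S = S} {b} (copy e o _) (fresh e′ ¬o) = contradiction
    (subst (λ a → OccursBefore S b [ a ]) (∷-injectiveˡ (trans (sym e) e′)) o) ¬o
  phrase-unique {S = S} {b} (copy _ _ (longestPreviousFactor p o l))
                            (copy _ _ (longestPreviousFactor p′ o′ l′)) =
    trans (prefix⇒take p)
          (trans (cong (λ k → take k (drop b S)) (≤-antisym (l′ _ p o) (l _ p′ o′)))
                 (sym (prefix⇒take p′)))

  from-unique : ∀ {S : List A} {b} Fs Gs → LZFrom S b Fs → LZFrom S b Gs → Fs ≡ Gs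
  from-unique [] [] _ _ = refl
  from-unique [] (([]) ∷ Gs) _ (_ , ne ∷ _ , _) = contradiction refl ne
  from-unique [] ((_ ∷ _) ∷ Gs) (e , _) (e′ , _) with trans e (sym e′)
  ... | ()
  from-unique (([]) ∷ Fs) [] (_ , ne ∷ _ , _) _ = contradiction refl ne
  from-unique ((_ ∷ _) ∷ Fs) [] (e , _) (e′ , _) with trans e (sym e′)
  ... | ()
  from-unique (F ∷ Fs) (G ∷ Gs) lz lz′
    with refl ← phrase-unique (head-phrase lz) (head-phrase lz′) =
    cong (F ∷_) (from-unique Fs Gs (uncons lz) (uncons lz′))

lz-unique : ∀ {S : List A} {Fs Gs} →
            IsLZFactorization S Fs → IsLZFactorization S Gs → Fs ≡ Gs
lz-unique (lzFactorization e ne ph) (lzFactorization e′ ne′ ph′) =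
  from-unique _ _ (e , ne , ph) (e′ , ne′ , ph′)

module _ (_≟ᴬ_ : DecidableEquality A) where

  private
    occursBefore? : (S : List A) (b : ℕ) (F : List A) → Dec (OccursBefore S b F)
    occursBefore? S b F = anyUpTo? (λ j → prefix? _≟ᴬ_ F (drop j S)) b

    phrase-exists : ∀ (S : List A) b {a T} → drop b S ≡ a ∷ T → ∃ (IsLZPhrase S b)
    phrase-exists S b {a} eq with occursBefore? S b [ a ]
    ... | no ¬occ = [ a ] , fresh eq ¬occ
    ... | yes occ@(j , j<b , _)
      with greatest (λ k → occursBefore? S b (take k (drop b S)))
                    (j , j<b , []) (length (drop b S))
    ...   | k , k≤N , o , max =
            take k (drop b S) , copy eq occ (longestPreviousFactor (take-prefix k _) o
              λ G p q → ≤-trans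
                (max (length G) (length-mono p) (subst (OccursBefore S b) (prefix⇒take p) q))
                (≤-reflexive (sym (trans (length-take k _) (m≤n⇒m⊓n≡m k≤N)))))

    from-exists : (S : List A) → ∀ fuel b T → drop b S ≡ T → length T ≤ fuel →
                  ∃ (LZFrom S b)
    from-exists S fuel       b []      eq le = [] , sym eq , [] , λ ()
    from-exists S (suc fuel) b (a ∷ T) eq le with phrase-exists S b eq
    ... | []     , p = contradiction refl (phrase-nonempty p)
    ... | x ∷ F′ , p with from-exists S fuel (b + suc (length F′)) _ refl shorter
      where
      shorter : length (drop (b + suc (length F′)) S) ≤ fuel
      shorter = ≤-trans
        (≤-reflexive (cong length (trans (sym (drop-drop b (suc (length F′)) S))
                                         (cong (drop (suc (length F′))) eq))))
        (≤-trans (drop-length (length F′) T) (≤-pred le))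
        where
        drop-length : ∀ k (U : List A) → length (drop k U) ≤ length U
        drop-length zero    U       = ≤-refl
        drop-length (suc k) []      = z≤n
        drop-length (suc k) (_ ∷ U) = m≤n⇒m≤1+n (drop-length k U)
    ...   | Fs , lz = (x ∷ F′) ∷ Fs , cons p lz

  lz-exists : (S : List A) → ∃ (IsLZFactorization S)
  lz-exists S with from-exists S (length S) 0 S refl ≤-refl
  ... | Fs , e , ne , ph = Fs , lzFactorization e ne ph

z : ∀ {σ} → List (Fin σ) → ℕ
z S = length (proj₁ (lz-exists Fin._≟_ S))

------------------------------------------------------------------------
-- Collage systems

-- substring S b e is S[b..e], both ends inclusive.
substring : List A → ℕ → ℕ → List A
substring S b e = take (suc e ∸ b) (drop b S)

-- The rules available for a nonterminal that has m predecessors, whose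
-- expansions are given by E.
data Rule (A : Set) {m : ℕ} (E : Fin m → List A) : Set where
  char  : A → Rule A E
  pair  : (j k : Fin m) → Rule A E
  power : (j : Fin m) (r : ℕ) → 2 ≤ r → Rule A E
  trunc : (j : Fin m) (b e : ℕ) → b ≤ e → e < length (E j) → Rule A E

expand : {E : Fin m → List A} → Rule A E → List A
expand         (char a)          = [ a ]
expand {E = E} (pair j k)        = E j ++ E k
expand {E = E} (power j r _)     = concat (replicate r (E j))
expand {E = E} (trunc j b e _ _) = substring (E j) b e

-- Collage A m is the type of systems of size m. Nonterminals are numbered
-- backwards: zero is the last one added, so in a system of size m the
-- index i : Fin m stands for X_{m - toℕ i}.
data Collage (A : Set) : ℕ → Set
exp : Collage A m → Fin m → List A

infixl 5 _▷_

data Collage A where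
  ε   : Collage A 0
  _▷_ : (G : Collage A m) → Rule A (exp G) → Collage A (suc m)

exp (G ▷ ρ) zero    = expand ρ
exp (G ▷ ρ) (suc i) = exp G i

Derives : Collage A m → List A → Set
Derives ε         S = ⊥
Derives G@(_ ▷ _) S = exp G zero ≡ S

DerivableInSize : List A → ℕ → Set
DerivableInSize {A} S m = Σ (Collage A m) λ G → Derives G S

-- c(S) = c. The minimum is a relation rather than a function because
-- exponents and intermediate expansions are unbounded, so there is no
-- evident algorithm for it; see minimum-unique and ¬¬-minimum-exists below.
IsMinCollageSize : List A → ℕ → Set
IsMinCollageSize S c = DerivableInSize S c × (∀ m → DerivableInSize S m → c ≤ m)

minimum-unique : ∀ {S : List A} {c c′} →
                 IsMinCollageSize S c → IsMinCollageSize S c′ → c ≡ c′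
minimum-unique (d , l) (d′ , l′) = ≤-antisym (l _ d′) (l′ _ d)

derivable : ∀ (a : A) S → ∃ (DerivableInSize (a ∷ S))
derivable a [] = 1 , ε ▷ char a , refl
derivable a (x ∷ S) with derivable x S
... | suc m , G@(_ ▷ _) , d =
  3 + m , G ▷ char a ▷ pair zero (suc zero) , cong (a ∷_) d

¬¬-minimum-exists : ∀ (S : List A) → S ≢ [] → ¬ ¬ ∃ (IsMinCollageSize S)
¬¬-minimum-exists []      ne _  = ne refl
¬¬-minimum-exists (a ∷ S) _  ¬∃ with derivable a S
... | m₀ , d₀ = <-rec (λ m → ¬ DerivableInSize (a ∷ S) m) step m₀ d₀
  where
  step : ∀ m → (∀ {k} → k < m → ¬ DerivableInSize (a ∷ S) k) →
         ¬ DerivableInSize (a ∷ S) m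
  step m ih d = ¬∃ (m , d , λ k dk → ≮⇒≥ λ k<m → ih k<m dk)

------------------------------------------------------------------------

fromℕ : ℕ → ℚᵘ
fromℕ n = mkℚᵘ (+ n) 0

{-# OPTIONS --safe #-}

-- Let M = 2 ^ m. Start from M distinct letters and switch them to M fresh letters
-- one at a time, in bit-reversed order of position. Each of the resulting
-- versions of length M is obtained from its predecessor with O(1) rules, so
-- the versions at times 1, …, M - 1 can be concatenated in any order with O(M)
-- rules. Concatenate them coarse to fine: times divisible by a higher power
-- of 2 come first. If t = s 2^l with s odd, then in the version at time t every
-- aligned block of length M / 2^l has exactly s switched letters, while in each
-- version placed before it, at a time s' 2^l with s' ≠ s, the corresponding
-- block has s' of them. As letters determine positions modulo M, the 2^l blocks
-- of this version have no earlier occurrence. This gives M / 2 disjoint novel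
-- segments for each l < m, hence z ≥ m M / 2, whereas the length is
-- about M ^ 2 and c = O(M). Padding by a power of one letter reaches all lengths.

module Submission where

open import Defs
open import Data.Bool.Base using (Bool; true; false)
open import Data.Fin.Base using (Fin; zero; suc; combine)
import Data.Fin.Properties as Fin
import Data.Integer.Base as ℤ
import Data.Integer.Properties as ℤ
open import Data.List.Base
  using (List; []; _∷_; [_]; _++_; concat; concatMap; drop; length; lookup; replicate; take)
open import Data.List.Properties
  using (++-assoc; ++-conicalʳ; ++-identityʳ; concatMap-++; drop-[]; drop-drop; length-++; ∷-injectiveˡ; ∷-injectiveʳ)
open import Data.List.Relation.Binary.Prefix.Heterogeneous using (Prefix; []; _∷_; _++ᵖ_)
open import Data.List.Relation.Binary.Prefix.Heterogeneous.Properties using (length-mono)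
open import Data.List.Relation.Unary.All as All using (All; []; _∷_)
import Data.List.Relation.Unary.All.Properties as All
open import Data.Nat.Base
open import Data.Nat.DivMod using (_mod_; m<n⇒m%n≡m)
open import Data.Nat.Logarithm using (⌈log₂_⌉; ⌈log₂⌉-mono-≤; ⌈log₂2^n⌉≡n)
open import Data.Nat.Properties
open import Data.Nat.Solver using (module +-*-Solver)
open import Data.Product.Base using (Σ; _,_; _×_; ∃-syntax; proj₁; proj₂)
open import Data.Rational.Unnormalised.Base as ℚᵘ using (ℚᵘ; 0ℚᵘ; mkℚᵘ; *≤*; *<*)
open import Data.Sum.Base using (_⊎_; inj₁; inj₂)
open import Algebra.Properties.CommutativeSemigroup +-commutativeSemigroup
  using () renaming (interchange to +-interchange)
open import Relation.Binary.PropositionalEquality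
  using (_≡_; _≢_; refl; sym; trans; cong; cong₂; subst; subst₂; module ≡-Reasoning)
open import Relation.Nullary using (¬_; yes; no; contradiction)

-- Novel segments and the number of LZ phrases

drop-length-++ : ∀ {A : Set} (xs : List A) {ys} → drop (length xs) (xs ++ ys) ≡ ys
drop-length-++ []       = refl
drop-length-++ (x ∷ xs) = drop-length-++ xs

prefix-++ : ∀ {A : Set} (xs : List A) {ys} → Prefix _≡_ xs (xs ++ ys)
prefix-++ []       = []
prefix-++ (x ∷ xs) = refl ∷ prefix-++ xs

-- `X` and `Y` agree on their first `length F` letters, and `G` at offset `d` ends within these.
-- This carries a segment inside a phrase over to the phrase's earlier occurrence.
prefix-replace : ∀ {A : Set} {F G X Y : List A} d → Prefix _≡_ F X → Prefix _≡_ F Y →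
                 Prefix _≡_ G (drop d X) → d + length G ≤ length F →
                 Prefix _≡_ G (drop d Y)
prefix-replace zero    _          _          []         _        = []
prefix-replace zero    (refl ∷ p) (refl ∷ q) (refl ∷ r) (s≤s le) =
  refl ∷ prefix-replace zero p q r le
prefix-replace (suc d) (refl ∷ p) (refl ∷ q) r          (s≤s le) = prefix-replace d p q r le

-- S[b..e-1] is a concatenation of k nonempty segments, none of which has an
-- occurrence in S starting before its own position.
data NovelSegments {A : Set} (S : List A) : ℕ → ℕ → ℕ → Set where
  []    : ∀ {b} → NovelSegments S b b 0
  novel : ∀ {b e k} (G : List A) → 0 < length G → Prefix _≡_ G (drop b S) →
          ¬ OccursBefore S b G → NovelSegments S (b + length G) e k →
          NovelSegments S b e (suc k)

_++ⁿ_ : ∀ {A : Set} {S : List A} {b c e k l} →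
        NovelSegments S b c k → NovelSegments S c e l → NovelSegments S b e (k + l)
[]                 ++ⁿ ms = ms
novel G ne p ¬o ns ++ⁿ ms = novel G ne p ¬o (ns ++ⁿ ms)

-- A phrase containing a whole novel segment and more would be a copy, and so
-- give an earlier occurrence of the segment; hence every segment contains the
-- last position of some phrase.
segments≤phrases : ∀ {A : Set} {S : List A} (Fs : List (List A)) {f b e k} → f ≤ b →
                   concat Fs ≡ drop f S →
                   (∀ i → IsLZPhrase S (f + start Fs i) (lookup Fs i)) →
                   NovelSegments S b e k → k ≤ length Fs
segments≤phrases _ _ _ _ [] = z≤n
segments≤phrases {S = S} [] {f} {b} f≤b eq _ (novel G ne p _ _) =
  contradiction (≤-trans ne (length-mono p)) (<⇒≱ (s≤s (≤-reflexive (cong length empty))))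
  where
  empty : drop b S ≡ []
  empty = begin
    drop b S                ≡⟨ cong (λ i → drop i S) (m+[n∸m]≡n f≤b) ⟨
    drop (f + (b ∸ f)) S    ≡⟨ drop-drop f (b ∸ f) S ⟨
    drop (b ∸ f) (drop f S) ≡⟨ cong (drop (b ∸ f)) eq ⟨
    drop (b ∸ f) []         ≡⟨ drop-[] (b ∸ f) ⟩
    []                      ∎ where open ≡-Reasoning
segments≤phrases {S = S} (F ∷ Fs) {f} {b} f≤b eq ph ns@(novel G ne p ¬o ms) = go
  where
  F-prefix : Prefix _≡_ F (drop f S)
  F-prefix = subst (Prefix _≡_ F) eq (prefix-++ F)

  eq′ : concat Fs ≡ drop (f + length F) S
  eq′ = begin
    concat Fs                             ≡⟨ drop-length-++ F ⟨
    drop (length F) (F ++ concat Fs)      ≡⟨ cong (drop (length F)) eq ⟩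
    drop (length F) (drop f S)            ≡⟨ drop-drop f (length F) S ⟩
    drop (f + length F) S                 ∎ where open ≡-Reasoning

  ph′ : ∀ i → IsLZPhrase S (f + length F + start Fs i) (lookup Fs i)
  ph′ i = subst (λ j → IsLZPhrase S j (lookup Fs i)) (sym (+-assoc f _ _)) (ph (suc i))

  F-phrase : IsLZPhrase S f F
  F-phrase = subst (λ j → IsLZPhrase S j F) (+-identityʳ f) (ph zero)

  not-inside : IsLZPhrase S f F → ¬ b + length G < f + length F
  -- A fresh phrase is a single letter, so with f ≤ b it cannot end after the nonempty `G`.
  not-inside (fresh _ _) lt = <⇒≱ lt (+-mono-≤ f≤b ne)
  not-inside (copy _ _ lpf) lt with IsLongestPreviousFactor.occurs lpf
  -- `G` keeps its offset b - f inside the copied phrase.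
  ... | j , j<f , q = ¬o (j + (b ∸ f) , bound , occ)
    where
    bound : j + (b ∸ f) < b
    bound = <-≤-trans (+-monoˡ-< (b ∸ f) j<f) (≤-reflexive (m+[n∸m]≡n f≤b))

    G-prefix : Prefix _≡_ G (drop (b ∸ f) (drop f S))
    G-prefix = subst (Prefix _≡_ G)
      (sym (trans (drop-drop f (b ∸ f) S) (cong (λ i → drop i S) (m+[n∸m]≡n f≤b)))) p

    fits : b ∸ f + length G ≤ length F
    fits = +-cancelˡ-≤ f _ _ (begin
      f + (b ∸ f + length G) ≡⟨ +-assoc f (b ∸ f) _ ⟨
      f + (b ∸ f) + length G ≡⟨ cong (_+ length G) (m+[n∸m]≡n f≤b) ⟩
      b + length G           ≤⟨ <⇒≤ lt ⟩
      f + length F           ∎) where open ≤-Reasoning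

    occ : Prefix _≡_ G (drop (j + (b ∸ f)) S)
    occ = subst (Prefix _≡_ G) (drop-drop j (b ∸ f) S)
            (prefix-replace (b ∸ f) F-prefix q G-prefix fits)

  go : _ ≤ suc (length Fs)
  go with f + length F ≤? b
  -- The phrase ends before `G` begins and is discarded.
  ... | yes le = m≤n⇒m≤1+n (segments≤phrases Fs le eq′ ph′ ns)
  -- Otherwise the phrase ends inside `G`, and both are removed; `not-inside` restores the invariant
  -- f ≤ b.
  ... | no  _  = s≤s (segments≤phrases Fs (≮⇒≥ (not-inside F-phrase)) eq′ ph′ ms)

segments≤z : ∀ {σ} {S : List (Fin σ)} {e k} → NovelSegments S 0 e k → k ≤ z S
segments≤z {S = S} = segments≤phrases (proj₁ fs) z≤n factors phrases
  where
  fs = lz-exists Fin._≟_ S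
  open IsLZFactorization (proj₂ fs)

-- Prefixes and concatenation

drop-length+ : ∀ {A : Set} (xs : List A) {ys} k → drop (length xs + k) (xs ++ ys) ≡ drop k ys
drop-length+ []       k = refl
drop-length+ (x ∷ xs) k = drop-length+ xs k

++-injective : ∀ {A : Set} (xs xs′ : List A) {ys ys′} → length xs ≡ length xs′ →
               xs ++ ys ≡ xs′ ++ ys′ → xs ≡ xs′ × ys ≡ ys′
++-injective []       []         _ eq = refl , eq
++-injective (x ∷ xs) (x′ ∷ xs′) l eq with ++-injective xs xs′ (suc-injective l) (∷-injectiveʳ eq)
... | p , q = cong₂ _∷_ (∷-injectiveˡ eq) p , q

prefix-unique : ∀ {A : Set} {F G X : List A} → length F ≡ length G →
                Prefix _≡_ F X → Prefix _≡_ G X → F ≡ G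
prefix-unique {F = []}    {[]}    _ _          _          = refl
prefix-unique {F = _ ∷ _} {_ ∷ _} l (refl ∷ p) (refl ∷ q) =
  cong (_ ∷_) (prefix-unique (suc-injective l) p q)

prefix-drop-++ : ∀ {A : Set} {F : List A} o X {Y} → Prefix _≡_ F (drop o X) → Prefix _≡_ F (drop o (X ++ Y))
prefix-drop-++ zero    X       p  = p ++ᵖ _
prefix-drop-++ (suc o) []      [] = []
prefix-drop-++ (suc o) (x ∷ X) p  = prefix-drop-++ o X p

prefix-++⁻ˡ : ∀ {A : Set} (F : List A) {G X} → Prefix _≡_ (F ++ G) X → Prefix _≡_ F X
prefix-++⁻ˡ []      p       = []
prefix-++⁻ˡ (_ ∷ F) (e ∷ p) = e ∷ prefix-++⁻ˡ F p

prefix-++⁻ʳ : ∀ {A : Set} (F : List A) {G X} → Prefix _≡_ (F ++ G) X → Prefix _≡_ G (drop (length F) X)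
prefix-++⁻ʳ []      p       = p
prefix-++⁻ʳ (_ ∷ F) (e ∷ p) = prefix-++⁻ʳ F p

-- The order of the times and the number of segments

infixl 7 _≪_
-- This is s * 2^k. Doubling first makes `s ≪ suc l` definitionally the even multiple `(s + s) ≪ l`.
_≪_ : ℕ → ℕ → ℕ
s ≪ zero  = s
s ≪ suc k = (s + s) ≪ k

+-≪ : ∀ a b k → (a + b) ≪ k ≡ a ≪ k + b ≪ k
+-≪ a b zero    = refl
+-≪ a b (suc k) = trans (cong (_≪ k) (+-interchange a b a b)) (+-≪ (a + a) (b + b) k)

2^suc : ∀ d → 2 ^ suc d ≡ 2 ^ d + 2 ^ d
2^suc d = cong (2 ^ d +_) (+-identityʳ (2 ^ d))

double≤ : ∀ {s h} → s ≤ 2 ^ h → s + s ≤ 2 ^ suc h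
double≤ {h = h} s≤ = ≤-trans (+-mono-≤ s≤ s≤) (≤-reflexive (sym (2^suc h)))

double≢odd : ∀ a b → a + a ≢ suc (b + b)
double≢odd a b eq = even≢odd a b (trans (2*n≡n+n a) (trans eq (cong suc (sym (2*n≡n+n b)))))
  where
  2*n≡n+n : ∀ n → 2 * n ≡ n + n
  2*n≡n+n n = cong (n +_) (+-identityʳ n)

-- Growing at the right end makes `level l k` the part of a level that precedes its next time, as
-- the induction in `level-novel` needs.
level : ℕ → ℕ → List ℕ
level l zero    = []
level l (suc k) = level l k ++ [ suc (k + k) ≪ l ]

-- The multiples of 2 ^ l strictly between 0 and 2 ^ (h + l); those divisible
-- by a higher power of 2 come first.
schedule : ℕ → ℕ → List ℕ
schedule zero    l = []
schedule (suc h) l = schedule h (suc l) ++ level l (2 ^ h)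

level-odd : ∀ l k → All (λ t → ∃[ j ] (j < k × t ≡ suc (j + j) ≪ l)) (level l k)
level-odd l zero    = []
level-odd l (suc k) = All.++⁺
  (All.map (λ { (j , j<k , t≡) → j , m≤n⇒m≤1+n j<k , t≡ }) (level-odd l k))
  ((k , ≤-refl , refl) ∷ [])

odd≤ : ∀ {k h} → k < 2 ^ h → suc (k + k) ≤ 2 ^ suc h
odd≤ {k} {h} k< = ≤-trans (s≤s (+-monoʳ-≤ k (n≤1+n k))) (double≤ {h = h} k<)

schedule-multiples : ∀ h l → All (λ t → ∃[ s ] (t ≡ s ≪ l × s ≤ 2 ^ h)) (schedule h l)
schedule-multiples zero    l = []
schedule-multiples (suc h) l = All.++⁺
  (All.map (λ { (s , t≡ , s≤) → s + s , t≡ , double≤ {h = h} s≤ }) (schedule-multiples h (suc l)))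
  (All.map (λ { (j , j< , t≡) → suc (j + j) , t≡ , odd≤ {h = h} j< }) (level-odd l (2 ^ h)))

length-level : ∀ l k → length (level l k) ≡ k
length-level l zero    = refl
length-level l (suc k) = trans (length-++ (level l k)) (trans (+-comm _ 1) (cong suc (length-level l k)))

length-schedule : ∀ h l → suc (length (schedule h l)) ≡ 2 ^ h
length-schedule zero    l = refl
length-schedule (suc h) l = begin
  suc (length (schedule h (suc l) ++ level l (2 ^ h)))
    ≡⟨ cong suc (length-++ (schedule h (suc l))) ⟩
  suc (length (schedule h (suc l))) + length (level l (2 ^ h))
    ≡⟨ cong₂ _+_ (length-schedule h (suc l)) (length-level l (2 ^ h)) ⟩
  2 ^ h + 2 ^ h
    ≡⟨ 2^suc h ⟨
  2 ^ suc h ∎ where open ≡-Reasoning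

-- The novel segments supplied by `schedule h l`: each of the 2^h times of the finest level
-- contributes 2^l blocks.
segments : ℕ → ℕ → ℕ
segments zero    l = 0
segments (suc h) l = segments h (suc l) + 2 ^ h * 2 ^ l

-- From one level to the next, l grows as h shrinks, so each of the h levels contributes the same
-- number, half of 2^(h + l).
segments≡ : ∀ h l → segments h l * 2 ≡ h * 2 ^ (h + l)
segments≡ zero    l = refl
segments≡ (suc h) l = begin
  (segments h (suc l) + 2 ^ h * 2 ^ l) * 2      ≡⟨ *-distribʳ-+ 2 (segments h (suc l)) _ ⟩
  segments h (suc l) * 2 + 2 ^ h * 2 ^ l * 2    ≡⟨ cong₂ _+_ (segments≡ h (suc l)) 2^* ⟩
  h * 2 ^ (h + suc l) + 2 ^ (suc h + l)         ≡⟨ cong (λ d → h * 2 ^ d + 2 ^ (suc h + l)) (+-suc h l) ⟩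
  h * 2 ^ (suc h + l) + 2 ^ (suc h + l)         ≡⟨ +-comm (h * 2 ^ (suc h + l)) _ ⟩
  suc h * 2 ^ (suc h + l)                       ∎
  where
  open ≡-Reasoning
  2^* : 2 ^ h * 2 ^ l * 2 ≡ 2 ^ (suc h + l)
  2^* = trans (*-comm (2 ^ h * 2 ^ l) 2) (cong (2 *_) (sym (^-distribˡ-+-* 2 h l)))

-- Versions and the novelty of their blocks

module Versions {A : Set} (letter : ℕ → Bool → A) where

  -- 2 ^ d cells at positions o, o + 1, …, of which t are switched on; the
  -- halving switches them on in bit-reversed order of position.
  version : ℕ → ℕ → ℕ → List A
  version zero    o t = [ letter o (0 <ᵇ t) ]
  version (suc d) o t = version d o ⌈ t /2⌉ ++ version d (o + 2 ^ d) ⌊ t /2⌋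

  length-version : ∀ d o t → length (version d o t) ≡ 2 ^ d
  length-version zero    o t = refl
  length-version (suc d) o t = begin
    length (version d o ⌈ t /2⌉ ++ version d (o + 2 ^ d) ⌊ t /2⌋)
      ≡⟨ length-++ (version d o ⌈ t /2⌉) ⟩
    length (version d o ⌈ t /2⌉) + length (version d (o + 2 ^ d) ⌊ t /2⌋)
      ≡⟨ cong₂ _+_ (length-version d o _) (length-version d _ _) ⟩
    2 ^ d + 2 ^ d
      ≡⟨ 2^suc d ⟨
    2 ^ suc d ∎ where open ≡-Reasoning

  version-double : ∀ d o a → version (suc d) o (a + a) ≡ version d o a ++ version d (o + 2 ^ d) a
  version-double d o a = cong₂ (λ x y → version d o x ++ version d (o + 2 ^ d) y)
    (sym (n≡⌈n+n/2⌉ a)) (sym (n≡⌊n+n/2⌋ a))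

  version-head : ∀ d o t → ∃[ x ] ∃[ T ] version d o t ≡ letter o x ∷ T
  version-head zero    o t = _ , _ , refl
  version-head (suc d) o t with version-head d o ⌈ t /2⌉
  ... | x , T , eq = x , _ , cong (_++ version d (o + 2 ^ d) ⌊ t /2⌋) eq

  drop-version : ∀ d o t {R} j → j < 2 ^ d →
                 ∃[ x ] ∃[ T ] drop j (version d o t ++ R) ≡ letter (o + j) x ∷ T
  drop-version zero    o t zero    j<   = _ , _ , cong (λ i → letter i _ ∷ _) (sym (+-identityʳ o))
  drop-version zero    o t (suc j) (s≤s ())
  drop-version (suc d) o t {R} j j< with j <? 2 ^ d
  ... | yes j<′ with drop-version d o ⌈ t /2⌉ j j<′
  ...   | x , T , eq = x , T , trans (cong (drop j) (++-assoc (version d o ⌈ t /2⌉) _ R)) eq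
  drop-version (suc d) o t {R} j j< | no j≮
    with drop-version d (o + 2 ^ d) ⌊ t /2⌋ {R} (j ∸ 2 ^ d)
           (+-cancelˡ-< (2 ^ d) _ _ (≤-<-trans (≤-reflexive (m+[n∸m]≡n (≮⇒≥ j≮)))
                                               (<-≤-trans j< (≤-reflexive (2^suc d)))))
  ...   | x , T , eq = x , T , (begin
    drop j ((V ++ W) ++ R)                   ≡⟨ cong (drop j) (++-assoc V W R) ⟩
    drop j (V ++ (W ++ R))                   ≡⟨ cong (λ i → drop i (V ++ (W ++ R))) j≡ ⟨
    drop (length V + j′) (V ++ (W ++ R))     ≡⟨ drop-length+ V j′ ⟩
    drop j′ (W ++ R)                         ≡⟨ eq ⟩
    letter (o + 2 ^ d + j′) x ∷ T            ≡⟨ cong (λ i → letter i x ∷ T) (+-assoc o _ j′) ⟩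
    letter (o + (2 ^ d + j′)) x ∷ T          ≡⟨ cong (λ i → letter (o + i) x ∷ T) (m+[n∸m]≡n (≮⇒≥ j≮)) ⟩
    letter (o + j) x ∷ T                     ∎)
    where
    open ≡-Reasoning
    V = version d o ⌈ t /2⌉
    W = version d (o + 2 ^ d) ⌊ t /2⌋
    j′ = j ∸ 2 ^ d
    j≡ : length V + j′ ≡ j
    j≡ = trans (cong (_+ j′) (length-version d o _)) (m+[n∸m]≡n (≮⇒≥ j≮))

  module Novelty (m : ℕ) (letter-injective : ∀ {i j x y} → i < 2 ^ m → j < 2 ^ m →
                          letter i x ≡ letter j y → i ≡ j × x ≡ y) where

    -- The halves determine ⌈s/2⌉ and ⌊s/2⌋, whose sum is s. At a single cell the bounds leave only
    -- 0 and 1, which have different letters.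
    version-injective : ∀ d {o s s′} → o + 2 ^ d ≤ 2 ^ m → s ≤ 2 ^ d → s′ ≤ 2 ^ d →
                        version d o s ≡ version d o s′ → s ≡ s′
    version-injective zero    {s = zero}        {zero}        _  _        _        _  = refl
    version-injective zero    {s = suc zero}    {suc zero}    _  _        _        _  = refl
    version-injective zero    {o = o} {zero}    {suc zero}    o≤ _        _        eq
      with letter-injective o< o< (∷-injectiveˡ eq)
      where o< = ≤-trans (≤-reflexive (+-comm 1 o)) o≤
    ... | _ , ()
    version-injective zero    {o = o} {suc zero} {zero}       o≤ _        _        eq
      with letter-injective o< o< (∷-injectiveˡ eq)
      where o< = ≤-trans (≤-reflexive (+-comm 1 o)) o≤
    ... | _ , ()
    version-injective zero    {s = suc (suc _)}               _  (s≤s ()) _        _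
    version-injective zero    {s′ = suc (suc _)}              _  _        (s≤s ()) _
    version-injective (suc d) {o} {s} {s′} o≤ s≤ s′≤ eq
      with ++-injective (version d o _) (version d o _)
             (trans (length-version d o _) (sym (length-version d o _))) eq
    ... | eq₁ , eq₂ = begin
      s                     ≡⟨ ⌊n/2⌋+⌈n/2⌉≡n s ⟨
      ⌊ s /2⌋ + ⌈ s /2⌉     ≡⟨ cong₂ _+_
                                 (version-injective d o₂≤ (half s≤) (half s′≤) eq₂)
                                 (version-injective d o₁≤ (half′ s≤) (half′ s′≤) eq₁) ⟩
      ⌊ s′ /2⌋ + ⌈ s′ /2⌉   ≡⟨ ⌊n/2⌋+⌈n/2⌉≡n s′ ⟩
      s′                    ∎
      where
      open ≡-Reasoning
      o₂≤ : o + 2 ^ d + 2 ^ d ≤ 2 ^ m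
      o₂≤ = ≤-trans (≤-reflexive (trans (+-assoc o _ _) (cong (o +_) (sym (2^suc d))))) o≤
      o₁≤ : o + 2 ^ d ≤ 2 ^ m
      o₁≤ = ≤-trans (m≤m+n _ _) o₂≤
      half′ : ∀ {a} → a ≤ 2 ^ suc d → ⌈ a /2⌉ ≤ 2 ^ d
      half′ a≤ = ≤-trans (⌈n/2⌉-mono (≤-trans a≤ (≤-reflexive (2^suc d))))
                         (≤-reflexive (sym (n≡⌈n+n/2⌉ _)))
      half : ∀ {a} → a ≤ 2 ^ suc d → ⌊ a /2⌋ ≤ 2 ^ d
      half {a} a≤ = ≤-trans (⌊n/2⌋≤⌈n/2⌉ a) (half′ a≤)

    versions : List ℕ → List A
    versions = concatMap (version m 0)

    -- The letters of a version determine their positions, so all occurrences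
    -- in a concatenation of versions are aligned.
    occurs-aligned : ∀ {F o x T t R} ts → F ≡ letter o x ∷ T → o < 2 ^ m →
                     All (λ t′ → ∀ R′ → ¬ Prefix _≡_ F (drop o (version m 0 t′ ++ R′))) ts →
                     ¬ OccursBefore (versions ts ++ (version m 0 t ++ R)) (length (versions ts) + o) F
    -- No version is left in front, so the start j < o lies in the current one, where the letter has
    -- position j and not o.
    occurs-aligned {t = t} [] refl o< _ (j , j<o , p)
      with drop-version m 0 t j (<-trans j<o o<)
    ... | _ , _ , eq with subst (Prefix _≡_ _) eq p
    ...   | e ∷ _ = <⇒≢ j<o (sym (proj₁ (letter-injective o< (<-trans j<o o<) e)))
    occurs-aligned {F} {o} {x} {T} {t} {R} (t′ ∷ ts) refl o< (¬p ∷ ¬ps) (j , j< , p)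
      with j <? 2 ^ m
    ... | yes j<2^m with drop-version m 0 t′ {versions ts ++ (version m 0 t ++ R)} j j<2^m
    ...   | _ , _ , eq
      with p′ ← subst (Prefix _≡_ F) (cong (drop j) (++-assoc (version m 0 t′) _ _)) p
      with subst (Prefix _≡_ F) eq p′
    -- The first letter forces j = o, where `F` is assumed not to occur.
    ...     | e ∷ _ with refl ← proj₁ (letter-injective o< j<2^m e) = ¬p _ p′
    -- A start beyond the first version is shifted back by 2^m.
    occurs-aligned {F} {o} {x} {T} {t} {R} (t′ ∷ ts) refl o< (¬p ∷ ¬ps) (j , j< , p)
        | no j≮ = occurs-aligned ts refl o< ¬ps (j′ , j′< , subst (Prefix _≡_ F) eq p)
      where
      V = version m 0 t′
      X = versions ts ++ (version m 0 t ++ R)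
      j′ = j ∸ 2 ^ m
      j≡ : length V + j′ ≡ j
      j≡ = trans (cong (_+ j′) (length-version m 0 t′)) (m+[n∸m]≡n (≮⇒≥ j≮))
      j′< : j′ < length (versions ts) + o
      j′< = +-cancelˡ-< (length V) _ _ (≤-<-trans (≤-reflexive j≡) (<-≤-trans j< (≤-reflexive
              (trans (cong (_+ o) (length-++ V)) (+-assoc (length V) _ o)))))
      eq : drop j ((V ++ versions ts) ++ (version m 0 t ++ R)) ≡ drop j′ X
      eq = trans (cong (drop j) (++-assoc V _ _))
                 (trans (cong (λ i → drop i (V ++ X)) (sym j≡)) (drop-length+ V j′))

    module Level (l h : ℕ) (l+h≡m : l + h ≡ m) (s : ℕ) (s≤ : s ≤ 2 ^ h) (ts : List ℕ)
                 (others : All (λ t → ∃[ s′ ] (t ≡ s′ ≪ l × s′ ≤ 2 ^ h × s′ ≢ s)) ts)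
                 {R : List A} where

      S : List A
      S = versions ts ++ (version m 0 (s ≪ l) ++ R)

      -- By alignment, an earlier occurrence would be the block at `o` of a version at some time
      -- `s′ ≪ l`. By `sub` this block is `version h o s′`, so `version-injective` gives s′ = s,
      -- against `others`.
      block-novel : ∀ o → o + 2 ^ h ≤ 2 ^ m →
                    (∀ s′ → Prefix _≡_ (version h o s′) (drop o (version m 0 (s′ ≪ l)))) →
                    ¬ OccursBefore S (length (versions ts) + o) (version h o s)
      block-novel o o≤ sub with version-head h o s
      ... | _ , _ , eq = occurs-aligned ts eq (≤-trans (m<m+n o (m^n>0 2 h)) o≤)
        (All.map (λ { (s′ , refl , s′≤ , s′≢s) R′ p → s′≢s (sym (version-injective h o≤ s≤ s′≤
          (prefix-unique (trans (length-version h o s) (sym (length-version h o s′)))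
             p (prefix-drop-++ o (version m 0 (s′ ≪ l)) (sub s′))))) }) others)

      -- s ≪ l is divisible by 2 ^ l, so every halving down to blocks of
      -- length 2 ^ h is exact, and all 2 ^ l blocks have the same parameter s.
      blocks-novel : ∀ k o b → b ≡ length (versions ts) + o → o + 2 ^ (k + h) ≤ 2 ^ m →
                     (∀ s′ → Prefix _≡_ (version (k + h) o (s′ ≪ k)) (drop o (version m 0 (s′ ≪ l)))) →
                     NovelSegments S b (b + 2 ^ (k + h)) (2 ^ k)
      blocks-novel zero o b refl o≤ sub =
        subst (λ n → NovelSegments S b (b + n) 1) (length-version h o s)
          (novel (version h o s) (subst (0 <_) (sym (length-version h o s)) (m^n>0 2 h)) located
             (block-novel o o≤ sub) [])
        where
        located : Prefix _≡_ (version h o s) (drop b S)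
        located = subst (Prefix _≡_ _) (sym (drop-length+ (versions ts) o))
                    (prefix-drop-++ o (version m 0 (s ≪ l)) (sub s))
      blocks-novel (suc k) o b b≡ o≤ sub =
        subst₂ (NovelSegments S b) (trans (+-assoc b D D) (cong (b +_) (sym (2^suc (k + h)))))
          (sym (2^suc k))
          (blocks-novel k o b b≡ (≤-trans (m≤m+n _ D) o₂≤) subˡ
            ++ⁿ blocks-novel k (o + D) (b + D) (trans (cong (_+ D) b≡) (+-assoc _ o D)) o₂≤ subʳ)
        where
        D = 2 ^ (k + h)
        o₂≤ : o + D + D ≤ 2 ^ m
        o₂≤ = ≤-trans (≤-reflexive (trans (+-assoc o D D) (cong (o +_) (sym (2^suc (k + h)))))) o≤
        sub₂ : ∀ s′ → Prefix _≡_ (version (k + h) o (s′ ≪ k) ++ version (k + h) (o + D) (s′ ≪ k))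
                                 (drop o (version m 0 (s′ ≪ l)))
        sub₂ s′ = subst (λ V → Prefix _≡_ V _)
                    (trans (cong (version (suc k + h) o) (+-≪ s′ s′ k)) (version-double (k + h) o (s′ ≪ k)))
                    (sub s′)
        subˡ : ∀ s′ → Prefix _≡_ (version (k + h) o (s′ ≪ k)) (drop o (version m 0 (s′ ≪ l)))
        subˡ s′ = prefix-++⁻ˡ (version (k + h) o (s′ ≪ k)) (sub₂ s′)
        subʳ : ∀ s′ → Prefix _≡_ (version (k + h) (o + D) (s′ ≪ k)) (drop (o + D) (version m 0 (s′ ≪ l)))
        subʳ s′ = subst (Prefix _≡_ _)
          (trans (drop-drop o _ _) (cong (λ d → drop (o + d) (version m 0 (s′ ≪ l)))
                                         (length-version (k + h) o (s′ ≪ k))))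
          (prefix-++⁻ʳ (version (k + h) o (s′ ≪ k)) (sub₂ s′))

      version-novel : NovelSegments S (length (versions ts)) (length (versions ts) + 2 ^ m) (2 ^ l)
      version-novel = subst (λ d → NovelSegments S b (b + 2 ^ d) (2 ^ l)) l+h≡m
        (blocks-novel l 0 b (sym (+-identityʳ b)) (≤-reflexive (cong (2 ^_) l+h≡m)) whole)
        where
        b = length (versions ts)
        whole : ∀ s′ → Prefix _≡_ (version (l + h) 0 (s′ ≪ l)) (version m 0 (s′ ≪ l))
        whole s′ = subst (λ d → Prefix _≡_ (version (l + h) 0 (s′ ≪ l)) (version d 0 (s′ ≪ l))) l+h≡m
          (subst (Prefix _≡_ _) (++-identityʳ _) (prefix-++ (version (l + h) 0 (s′ ≪ l))))

    versions-++ : ∀ ts us → versions (ts ++ us) ≡ versions ts ++ versions us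
    versions-++ = concatMap-++ (version m 0)

    -- Induction on the number k of versions of the level placed so far; the next one adds its 2^l
    -- blocks, each of length 2^(h + 1).
    level-novel : ∀ l h k {S R} → l + suc h ≡ m → k ≤ 2 ^ h →
                  let ts = schedule h (suc l) in
                  S ≡ versions (ts ++ level l k) ++ R →
                  NovelSegments S (length (versions ts)) (length (versions (ts ++ level l k))) (k * 2 ^ l)
    level-novel l h zero {S} eq k≤ S≡ =
      subst (λ us → NovelSegments S (length (versions ts)) (length (versions us)) 0)
        (sym (++-identityʳ ts)) []
      where ts = schedule h (suc l)
    level-novel l h (suc k) {S} {R} eq k< refl =
      subst₂ (NovelSegments S _) end≡ (+-comm (k * 2 ^ l) (2 ^ l))
        (level-novel l h k eq (<⇒≤ k<) S≡
          ++ⁿ subst (λ S → NovelSegments S _ _ _) (sym S≡)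
                (Level.version-novel l (suc h) eq s s≤ us others))
      where
      ts = schedule h (suc l)
      s = suc (k + k)
      us = ts ++ level l k
      s≤ : s ≤ 2 ^ suc h
      s≤ = odd≤ {h = h} k<
      us≡ : versions (ts ++ (level l k ++ [ s ≪ l ])) ≡ versions us ++ version m 0 (s ≪ l)
      us≡ = begin
        versions (ts ++ (level l k ++ [ s ≪ l ]))    ≡⟨ cong versions (++-assoc ts _ _) ⟨
        versions (us ++ [ s ≪ l ])                   ≡⟨ versions-++ us _ ⟩
        versions us ++ (version m 0 (s ≪ l) ++ [])   ≡⟨ cong (versions us ++_) (++-identityʳ _) ⟩
        versions us ++ version m 0 (s ≪ l)           ∎ where open ≡-Reasoning
      S≡ : S ≡ versions us ++ (version m 0 (s ≪ l) ++ R)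
      S≡ = trans (cong (_++ R) us≡) (++-assoc (versions us) _ R)
      end≡ : length (versions us) + 2 ^ m ≡ length (versions (ts ++ level l (suc k)))
      end≡ = sym (trans (cong length us≡) (trans (length-++ (versions us))
               (cong (length (versions us) +_) (length-version m 0 (s ≪ l)))))
      others : All (λ t → ∃[ s′ ] (t ≡ s′ ≪ l × s′ ≤ 2 ^ suc h × s′ ≢ s)) us
      others = All.++⁺
        -- Times of coarser levels have even factors, while s is odd.
        (All.map (λ { (s′ , t≡ , s′≤) → s′ + s′ , t≡ , double≤ {h = h} s′≤ , double≢odd s′ k })
          (schedule-multiples h (suc l)))
        -- Earlier times of the same level have smaller odd factors.
        (All.map (λ { (j , j<k , t≡) → suc (j + j) , t≡
                    , ≤-trans (s≤s (<⇒≤ (+-mono-< j<k j<k))) s≤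
                    , λ e → <⇒≢ (+-mono-< j<k j<k) (suc-injective e) })
          (level-odd l k))

    -- The coarser levels fill a prefix of `S`; for the recursive call the finest level is moved
    -- into `R`.
    schedule-novel : ∀ h l {S R} → l + h ≡ m → S ≡ versions (schedule h l) ++ R →
                     NovelSegments S 0 (length (versions (schedule h l))) (segments h l)
    schedule-novel zero    l       _  _  = []
    schedule-novel (suc h) l {R = R} eq S≡ =
      schedule-novel h (suc l) (trans (sym (+-suc l h)) eq)
        (trans S≡ (trans (cong (_++ R) (versions-++ (schedule h (suc l)) _)) (++-assoc (versions (schedule h (suc l))) _ R)))
        ++ⁿ level-novel l h (2 ^ h) eq ≤-refl S≡

-- Editing strings by collage rules

module _ {A : Set} where

  -- Any nonterminal may derive the string, so one growing system can hold all versions at once.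
  Has : ∀ {k} → Collage A k → List A → Set
  Has G S = ∃[ i ] exp G i ≡ S

  weaken : ∀ {k} {G : Collage A k} {ρ S} → Has G S → Has (G ▷ ρ) S
  weaken (i , eq) = suc i , eq

  substring-middle : ∀ (u : List A) a w v →
                     substring (u ++ (a ∷ w) ++ v) (length u) (length u + length w) ≡ a ∷ w
  substring-middle u a w v = begin
    take (suc (length u + length w) ∸ length u) (drop (length u) (u ++ (a ∷ w) ++ v))
      ≡⟨ cong₂ take (trans (cong (_∸ length u) (sym (+-suc (length u) (length w))))
                           (m+n∸m≡n (length u) _))
                    (drop-length-++ u) ⟩
    take (length (a ∷ w)) ((a ∷ w) ++ v)
      ≡⟨ take-length-++ (a ∷ w) ⟩
    a ∷ w ∎
    where
    open ≡-Reasoning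
    take-length-++ : ∀ (xs : List A) {ys} → take (length xs) (xs ++ ys) ≡ xs
    take-length-++ []       = refl
    take-length-++ (x ∷ xs) = cong (x ∷_) (take-length-++ xs)

  -- Truncation has inclusive ends and yields only nonempty strings, hence the form `a ∷ w` of the
  -- factor.
  middle-rule : ∀ {k} (G : Collage A k) u a w v → Has G (u ++ (a ∷ w) ++ v) →
                ∃[ ρ ] expand {E = exp G} ρ ≡ a ∷ w
  middle-rule G u a w v (i , eq) =
    trunc i (length u) (length u + length w) (m≤m+n _ _) e<
    , trans (cong (λ S → substring S (length u) (length u + length w)) eq) (substring-middle u a w v)
    where
    e< : length u + length w < length (exp G i)
    e< = begin
      suc (length u + length w)            ≡⟨ +-suc (length u) (length w) ⟨
      length u + length (a ∷ w)            ≤⟨ +-monoʳ-≤ (length u) (m≤m+n _ (length v)) ⟩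
      length u + (length (a ∷ w) + length v) ≡⟨ cong (length u +_) (length-++ (a ∷ w)) ⟨
      length u + length ((a ∷ w) ++ v)     ≡⟨ length-++ u ⟨
      length (u ++ (a ∷ w) ++ v)           ≡⟨ cong length eq ⟨
      length (exp G i)                     ∎ where open ≤-Reasoning

  -- The five rules are two truncations for the parts around the edited letter, the new letter, and
  -- two concatenations.
  substitute : ∀ {k} (G : Collage A k) a u x b r y → Has G ((a ∷ u) ++ x ∷ b ∷ r) →
               Σ (Collage A (5 + k)) λ G′ →
                 (∀ {S} → Has G S → Has G′ S) × Has G′ ((a ∷ u) ++ y ∷ b ∷ r)
  substitute {k} G a u x b r y has = G₅
    , (λ h → weaken (weaken (weaken (weaken (weaken h)))))
    , zero , cong₂ (λ p q → p ++ y ∷ q) (proj₂ left) (proj₂ right)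
    where
    left  = middle-rule G [] a u (x ∷ b ∷ r) has
    G₁ = G ▷ proj₁ left
    has′ : Has G₁ (((a ∷ u) ++ [ x ]) ++ (b ∷ r) ++ [])
    has′ = subst (Has G₁)
      (sym (trans (++-assoc (a ∷ u) [ x ] _) (cong (λ s → (a ∷ u) ++ x ∷ s) (++-identityʳ (b ∷ r)))))
      (weaken has)
    right = middle-rule G₁ ((a ∷ u) ++ [ x ]) b r [] has′
    G₄ : Collage A (4 + k)
    G₄ = G₁ ▷ proj₁ right ▷ char y ▷ pair zero (suc zero)
    G₅ : Collage A (5 + k)
    G₅ = G₄ ▷ pair (suc (suc (suc zero))) zero

  derivable-size : ∀ (a : A) S → proj₁ (derivable a S) ≡ suc (length S + length S)
  derivable-size a []      = refl
  derivable-size a (x ∷ S) with derivable x S | derivable-size x S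
  ... | suc k , G ▷ ρ , d | refl = cong (λ n → suc (suc n)) (sym (+-suc (length S) (length S)))

  length-power : ∀ (a : A) r → length (concat (replicate r [ a ])) ≡ r
  length-power a zero    = refl
  length-power a (suc r) = cong suc (length-power a r)

-- A collage system of size O(2^m) for the word

halves : ∀ t → ⌈ t /2⌉ ≡ ⌊ t /2⌋ ⊎ ⌈ t /2⌉ ≡ suc ⌊ t /2⌋
halves zero          = inj₁ refl
halves (suc zero)    = inj₂ refl
halves (suc (suc t)) with halves t
... | inj₁ eq = inj₁ (cong suc eq)
... | inj₂ eq = inj₂ (cong suc eq)

module Construction {A : Set} (letter : ℕ → Bool → A) (m : ℕ) where
  open Versions letter

  -- Going from t to t + 1 changes the first half if t is even and the second if t is odd, so
  -- recursion ends at one cell. The letters `x` and `y` coincide once all cells are on.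
  version-edit : ∀ d o t → ∃[ u ] ∃[ x ] ∃[ y ] ∃[ r ]
                 (version d o t ≡ u ++ x ∷ r × version d o (suc t) ≡ u ++ y ∷ r)
  version-edit zero    o t = [] , _ , _ , [] , refl , refl
  version-edit (suc d) o t with halves t
  ... | inj₁ eq rewrite eq with version-edit d o ⌊ t /2⌋
  ...   | u , x , y , r , p , q = u , x , y , _ , extend p , extend q
    where
    W = version d (o + 2 ^ d) ⌊ t /2⌋
    extend : ∀ {V x} → V ≡ u ++ x ∷ r → V ++ W ≡ u ++ x ∷ (r ++ W)
    extend p = trans (cong (_++ W) p) (++-assoc u _ W)
  version-edit (suc d) o t | inj₂ eq rewrite eq with version-edit d (o + 2 ^ d) ⌊ t /2⌋
  ...   | u , x , y , r , p , q = V ++ u , x , y , r , extend p , extend q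
    where
    V = version d o (suc ⌊ t /2⌋)
    extend : ∀ {W x} → W ≡ u ++ x ∷ r → V ++ W ≡ (V ++ u) ++ x ∷ r
    extend p = trans (cong (V ++_) p) (sym (++-assoc V u _))

  c : A
  c = letter 0 true

  -- The border makes both sides of every edited position nonempty.
  framed : ℕ → List A
  framed t = c ∷ (version m 0 t ++ [ c ])

  framed-edit : ∀ t → ∃[ u ] ∃[ x ] ∃[ y ] ∃[ b ] ∃[ r ]
                (framed t ≡ (c ∷ u) ++ x ∷ b ∷ r × framed (suc t) ≡ (c ∷ u) ++ y ∷ b ∷ r)
  framed-edit t with version-edit m 0 t
  ... | u , x , y , r , p , q with r ++ [ c ] in r≡
  ...   | []     = contradiction (++-conicalʳ r [ c ] r≡) λ ()
  ...   | b ∷ r′ = u , x , y , b , r′ , frame p , frame q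
    where
    frame : ∀ {V x} → V ≡ u ++ x ∷ r → c ∷ (V ++ [ c ]) ≡ (c ∷ u) ++ x ∷ b ∷ r′
    frame {x = x} p = cong (c ∷_) (trans (cong (_++ [ c ]) p)
      (trans (++-assoc u _ [ c ]) (cong (λ s → u ++ x ∷ s) r≡)))

  initial : ∃[ k ] (k ≡ suc (suc (2 ^ m) + suc (2 ^ m)) × Σ (Collage A k) λ G → Has G (framed 0))
  initial with derivable c (version m 0 0 ++ [ c ]) | derivable-size c (version m 0 0 ++ [ c ])
  ... | k , G@(_ ▷ _) , d | size = k , trans size (cong (λ n → suc (n + n)) len) , G , zero , d
    where
    len : length (version m 0 0 ++ [ c ]) ≡ suc (2 ^ m)
    len = trans (length-++ (version m 0 0)) (trans (+-comm _ 1) (cong suc (length-version m 0 0)))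

  module _ {k₀} (G₀ : Collage A k₀) (has₀ : Has G₀ (framed 0)) where

    family : ∀ T → Σ (Collage A (T * 5 + k₀)) λ G → ∀ t → t ≤ T → Has G (framed t)
    family zero = G₀ , λ { _ z≤n → has₀ }
    family (suc T) with family T | framed-edit T
    ... | G , has | u , x , y , b , r , p , q with substitute G c u x b r y (subst (Has G) p (has T ≤-refl))
    ...   | G′ , mono , has′ = G′ , λ t t≤ → new t (m≤n⇒m<n∨m≡n t≤)
      where
      new : ∀ t → t < suc T ⊎ t ≡ suc T → Has G′ (framed t)
      new t (inj₁ t<)   = mono (has t (≤-pred t<))
      new _ (inj₂ refl) = subst (Has G′) (sym q) has′

  -- Works from right to left, starting from `P`: each version is cut out of its frame and put in
  -- front, two rules apiece.
  assemble : ∀ {k P} (G : Collage A (suc k)) → exp G zero ≡ P → ∀ ts → All (λ t → Has G (framed t)) ts →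
             Σ (Collage A (suc (length ts * 2 + k))) λ G′ →
               (∀ {S} → Has G S → Has G′ S) × exp G′ zero ≡ concatMap (version m 0) ts ++ P
  assemble G eq []       _            = G , (λ h → h) , eq
  assemble {P = P} G eq (t ∷ ts) (has ∷ hass) with assemble G eq ts hass
  ... | G′ , mono , eq′ with version-head m 0 t
  ...   | x , T , V≡ with middle-rule G′ [ c ] _ T [ c ] (subst (λ V → Has G′ (c ∷ (V ++ [ c ]))) V≡ (mono has))
  ...     | ρ , ρ≡ = G′ ▷ ρ ▷ pair zero (suc zero) , (λ h → weaken (weaken (mono h)))
                   , trans (cong₂ _++_ (trans ρ≡ (sym V≡)) eq′) (sym (++-assoc (version m 0 t) _ P))

  -- The tail of `c` adjusts the length. It may reuse a cell letter, because `schedule-novel` allows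
  -- any continuation `R`.
  word : ℕ → List A
  word r = concatMap (version m 0) (schedule m 0) ++ concat (replicate r [ c ])

  word-size : ∀ r → 2 ≤ r → ∃[ k ] (k ≤ 16 * 2 ^ m × DerivableInSize (word r) k)
  word-size r 2≤r with initial
  ... | k₀ , k₀≡ , G₀ , has₀ with family G₀ has₀ (2 ^ m)
  ...   | G , has
    with assemble (G ▷ char c ▷ power zero r 2≤r) refl (schedule m 0)
           (All.map (λ { (s , refl , s≤) → weaken (weaken (has s s≤)) }) (schedule-multiples m 0))
  ...     | G′@(_ ▷ _) , _ , eq = _ , size , G′ , eq
    where
    -- With M = 2^m the size is 9 M + 3: 2 M + 3 for the initial frame, 5 M for the edits, 2 for the
    -- tail and 2 (M - 1) for assembling. The constant 16 leaves slack.
    size : suc (length (schedule m 0) * 2 + suc (2 ^ m * 5 + k₀)) ≤ 16 * 2 ^ m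
    size = begin
      suc (L * 2 + suc (M * 5 + k₀)) ≡⟨ cong (λ k → suc (L * 2 + suc (M * 5 + k))) k₀≡ ⟩
      suc (L * 2 + suc (M * 5 + suc (suc M + suc M)))
        ≡⟨ solve 2 (λ L M → con 1 :+ (L :* con 2 :+ (con 1 :+ (M :* con 5 :+ (con 1 :+ ((con 1 :+ M) :+ (con 1 :+ M))))))
                       := (con 1 :+ L) :* con 2 :+ M :* con 7 :+ con 3) refl L M ⟩
      suc L * 2 + M * 7 + 3          ≡⟨ cong (λ n → n * 2 + M * 7 + 3) (length-schedule m 0) ⟩
      M * 2 + M * 7 + 3              ≤⟨ +-monoʳ-≤ (M * 2 + M * 7) (*-monoˡ-≤ 3 (m^n>0 2 m)) ⟩
      M * 2 + M * 7 + M * 3          ≤⟨ m≤m+n _ (M * 4) ⟩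
      M * 2 + M * 7 + M * 3 + M * 4
        ≡⟨ solve 1 (λ M → M :* con 2 :+ M :* con 7 :+ M :* con 3 :+ M :* con 4 := con 16 :* M) refl M ⟩
      16 * M ∎
      where
      open ≤-Reasoning
      open +-*-Solver
      L = length (schedule m 0)
      M = 2 ^ m

  length-word : ∀ n → 1 ≤ m → 2 ^ (m + m) ≤ n → ∃[ r ] (2 ≤ r × length (word r) ≡ n)
  length-word n 1≤m sq≤ = n ∸ V , 2≤r , len
    where
    V = length (concatMap (version m 0) (schedule m 0))
    lengths : ∀ ts → length (concatMap (version m 0) ts) ≡ length ts * 2 ^ m
    lengths []       = refl
    lengths (t ∷ ts) = trans (length-++ (version m 0 t)) (cong₂ _+_ (length-version m 0 t) (lengths ts))
    -- The 2^m - 1 versions leave at least 2^m ≥ 2 of the n letters, enough for the exponent of a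
    -- power rule.
    2+V≤ : 2 + V ≤ n
    2+V≤ = begin
      2 + V                                   ≤⟨ +-monoˡ-≤ V (^-monoʳ-≤ 2 1≤m) ⟩
      2 ^ m + V                               ≡⟨ cong (2 ^ m +_) (lengths (schedule m 0)) ⟩
      suc (length (schedule m 0)) * 2 ^ m     ≡⟨ cong (_* 2 ^ m) (length-schedule m 0) ⟩
      2 ^ m * 2 ^ m                           ≡⟨ ^-distribˡ-+-* 2 m m ⟨
      2 ^ (m + m)                             ≤⟨ sq≤ ⟩
      n                                       ∎ where open ≤-Reasoning
    2≤r : 2 ≤ n ∸ V
    2≤r = m+n≤o⇒m≤o∸n 2 2+V≤
    len : length (word (n ∸ V)) ≡ n
    len = trans (length-++ (concatMap (version m 0) (schedule m 0)))
            (trans (cong (V +_) (length-power c (n ∸ V))) (m+[n∸m]≡n (≤-trans (m≤n+m V 2) 2+V≤)))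

-- Choice of m, the alphabet and the constant

square-bracket : ∀ n → 4 ≤ n → ∃[ m ] (1 ≤ m × 2 ^ (m + m) ≤ n × n ≤ 2 ^ (2 + (m + m)))
square-bracket (suc n) 4≤1+n with m≤n⇒m<n∨m≡n 4≤1+n
... | inj₂ refl = 1 , ≤-refl , ≤-refl , m≤m+n 4 12
... | inj₁ 4<1+n with square-bracket n (≤-pred 4<1+n)
...   | m , 1≤m , lo , hi with suc n ≤? 2 ^ (2 + (m + m))
...     | yes hi′ = m , 1≤m , m≤n⇒m≤1+n lo , hi′
-- Once n + 1 exceeds 4^(m + 1), the next m takes over, and the failed comparison is its lower
-- bound.
...     | no  hi≱ = suc m , s≤s z≤n
                  , ≤-trans (≤-reflexive (cong (λ d → 2 ^ suc d) (+-suc m m))) (<⇒≤ (≰⇒> hi≱))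
                  , (begin
    suc n                       ≤⟨ s≤s hi ⟩
    suc (2 ^ (2 + (m + m)))     ≤⟨ ^-monoʳ-< 2 (s≤s (s≤s z≤n)) (n<1+n (2 + (m + m))) ⟩
    2 ^ (3 + (m + m))           ≤⟨ ^-monoʳ-≤ 2 (+-monoʳ-≤ 3 (+-monoʳ-≤ m (n≤1+n m))) ⟩
    2 ^ (2 + (suc m + suc m))   ∎)
  where open ≤-Reasoning

module Alphabet (m : ℕ) where

  instance
    2^m≢0 : NonZero (2 ^ m)
    2^m≢0 = m^n≢0 2 m

  bit : Bool → Fin 2
  bit false = zero
  bit true  = suc zero

  bit-injective : ∀ {x y} → bit x ≡ bit y → x ≡ y
  bit-injective {false} {false} _ = refl
  bit-injective {true}  {true}  _ = refl

  -- Reduction modulo 2^m makes the function total; on the positions of cells it is the identity.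
  letter : ℕ → Bool → Fin (2 ^ m * 2)
  letter i x = combine (i mod 2 ^ m) (bit x)

  letter-injective : ∀ {i j x y} → i < 2 ^ m → j < 2 ^ m → letter i x ≡ letter j y → i ≡ j × x ≡ y
  letter-injective {i} {j} {x} {y} i< j< eq
    with Fin.combine-injective (i mod 2 ^ m) (bit x) (j mod 2 ^ m) (bit y) eq
  ... | i≡j , x≡y = trans (sym (m<n⇒m%n≡m i<)) (trans (Fin.fromℕ<-injective _ _ _ _ i≡j) (m<n⇒m%n≡m j<))
                  , bit-injective x≡y

-- This is 1/128, the denominator being stored minus one: 4 from log n ≤ 4 m, 16 from the collage
-- size, 2 from z ≥ m 2^m / 2.
κ : ℚᵘ
κ = mkℚᵘ (ℤ.+ 1) 127

κ-bound : ∀ a b d → a * b ≤ d * 128 → κ ℚᵘ.* fromℕ a ℚᵘ.* fromℕ b ℚᵘ.≤ fromℕ d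
κ-bound a b d le = *≤* (subst₂ ℤ._≤_ lhs (ℤ.pos-* d 128) (ℤ.+≤+ le))
  where
  lhs : ℤ.+ (a * b) ≡ ℤ.+ 1 ℤ.* ℤ.+ a ℤ.* ℤ.+ b ℤ.* ℤ.+ 1
  lhs = trans (ℤ.pos-* a b) (sym (trans (ℤ.*-identityʳ _) (cong (ℤ._* ℤ.+ b) (ℤ.*-identityˡ (ℤ.+ a)))))

theorem14 : ∃[ κ ] (0ℚᵘ ℚᵘ.< κ × (∃[ n₀ ] (∀ (n : ℕ) → n₀ ≤ n →
    ∃[ σ ] Σ (List (Fin σ)) λ Y → length Y ≡ n ×
    (∀ (c : ℕ) → IsMinCollageSize Y c →
    κ ℚᵘ.* fromℕ ⌈log₂ n ⌉ ℚᵘ.* fromℕ c ℚᵘ.≤ fromℕ (z Y)))))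
theorem14 = κ , *<* (ℤ.+<+ (s≤s z≤n)) , 4 , construction
  where
  construction : ∀ n → 4 ≤ n → ∃[ σ ] Σ (List (Fin σ)) λ Y → length Y ≡ n ×
    (∀ c → IsMinCollageSize Y c → κ ℚᵘ.* fromℕ ⌈log₂ n ⌉ ℚᵘ.* fromℕ c ℚᵘ.≤ fromℕ (z Y))
  construction n 4≤n with square-bracket n 4≤n
  ... | m , 1≤m , lo , hi with Construction.length-word (Alphabet.letter m) m n 1≤m lo
  ...   | r , 2≤r , len = _ , word r , len , bound
    where
    open Alphabet m
    open Construction letter m
    open Versions.Novelty letter m letter-injective

    log≤ : ⌈log₂ n ⌉ ≤ 4 * m
    log≤ = begin
      ⌈log₂ n ⌉                   ≤⟨ ⌈log₂⌉-mono-≤ hi ⟩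
      ⌈log₂ 2 ^ (2 + (m + m)) ⌉   ≡⟨ ⌈log₂2^n⌉≡n (2 + (m + m)) ⟩
      -- The additive 2 is absorbed by m ≥ 1, which the threshold n ≥ 4 provides.
      2 + (m + m)                 ≤⟨ +-monoˡ-≤ (m + m) (*-monoʳ-≤ 2 1≤m) ⟩
      2 * m + (m + m)             ≡⟨ solve 1 (λ m → con 2 :* m :+ (m :+ m) := con 4 :* m) refl m ⟩
      4 * m                       ∎
      where
      open ≤-Reasoning
      open +-*-Solver

    z≥ : segments m 0 ≤ z (word r)
    z≥ = segments≤z (schedule-novel m 0 refl refl)

    bound : ∀ c → IsMinCollageSize (word r) c → κ ℚᵘ.* fromℕ ⌈log₂ n ⌉ ℚᵘ.* fromℕ c ℚᵘ.≤ fromℕ (z (word r))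
    bound c (_ , min) with word-size r 2≤r
    ... | k , k≤ , d = κ-bound ⌈log₂ n ⌉ c (z (word r)) (begin
      ⌈log₂ n ⌉ * c             ≤⟨ *-mono-≤ log≤ (≤-trans (min k d) k≤) ⟩
      4 * m * (16 * 2 ^ m)      ≡⟨ solve 2 (λ m M → con 4 :* m :* (con 16 :* M) := m :* M :* con 64) refl m (2 ^ m) ⟩
      m * 2 ^ m * 64            ≡⟨ cong (λ d → m * 2 ^ d * 64) (+-identityʳ m) ⟨
      m * 2 ^ (m + 0) * 64      ≡⟨ cong (_* 64) (segments≡ m 0) ⟨
      segments m 0 * 2 * 64     ≡⟨ *-assoc (segments m 0) 2 64 ⟩
      segments m 0 * 128        ≤⟨ *-monoˡ-≤ 128 z≥ ⟩
      z (word r) * 128          ∎)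
      where
      open ≤-Reasoning
      open +-*-Solver
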